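{- Let $\mathbf{\Pi}$ be the Hopf monoid of set partitions over $\mathbb{Q}$, with basis $\{\mathbf{x}_A\}$ as defined in the context. (1) Let $S=S_1\sqcup S_2$ be a finite set, $A\vdash S_1$, and $B\vdash S_2$. Then $$\mu_{S_1,S_2}(\mathbf{x}_A\otimes \mathbf{x}_B)=\mathbf{x}_{A\sqcup B}.$$ (2) Let $S=S_1\sqcup S_2$ be a finite set and $A\vdash S$. Then $$\Delta_{S_1,S_2}(\mathbf{x}_A)=\sum_{B\vdash S_1,\; C\vdash S_2} c_{B,C}\, \mathbf{x}_{B} \otimes \mathbf{x}_{C},$$ where $$c_{B,C}=\sum_{D} u(D,A),$$ the sum being over all set partitions $D\vdash S$ such that $D=D|_{S_1}\sqcup D|_{S_2}$, $D\leq A$, $B\leq D|_{S_1}$, and $C\leq D|_{S_2}$.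
   Context: A set partition $A$ of a finite set $S$, written $A\vdash S$, is a collection of disjoint nonempty subsets (blocks) of $S$ with union $S$; the empty set has a unique set partition $\emptyset$. A decomposition $S=S_1\sqcup S_2$ is an ordered pair of disjoint (possibly empty) subsets of $S$ with union $S$. For $A\vdash S$ and $T\subseteq S$, $A|_T\vdash T$ is the set partition whose blocks are the nonempty intersections of blocks of $A$ with $T$. For $S=S_1\sqcup S_2$, $A\vdash S_1$, $B\vdash S_2$, the disjoint union $A\sqcup B\vdash S$ is the set partition whose blocks are the blocks of $A$ together with the blocks of $B$. Set partitions of $S$ are ordered by refinement: $B\leq A$ if each block of $B$ is contained in some block of $A$. $u$ denotes the Möbius function of this lattice; for $B\le A$, $u(B,A)=\prod_{i}(-1)^{\lambda_i-1}(\lambda_i-1)!$, where $\lambda_i$ is the number of blocks of $B$ contained in the $i$th block of $A$. For a finite set $S$, $\mathbf{\Pi}[S]$ is the $\mathbb{Q}$-vector space with basis $\{\mathbf{m}_A : A\vdash S\}$. For $S=S_1\sqcup S_2$, the product $\mu_{S_1,S_2}:\mathbf{\Pi}[S_1]\otimes\mathbf{\Pi}[S_2]\to\mathbf{\Pi}[S]$ and coproduct $\Delta_{S_1,S_2}:\mathbf{\Pi}[S]\to\mathbf{\Pi}[S_1]\otimes\mathbf{\Pi}[S_2]$ are the linear maps given by $$\mu_{S_1,S_2}(\mathbf{m}_A\otimes\mathbf{m}_B)=\sum_{C\vdash S:\ C|_{S_1}=A,\ C|_{S_2}=B}\mathbf{m}_C,$$ $$\Delta_{S_1,S_2}(\mathbf{m}_A)=\begin{cases}\mathbf{m}_{A|_{S_1}}\otimes\mathbf{m}_{A|_{S_2}}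 & \text{if } A=A|_{S_1}\sqcup A|_{S_2},\\ 0&\text{otherwise.}\end{cases}$$ Two further bases of $\mathbf{\Pi}[S]$ are $$\mathbf{p}_A=\sum_{B\geq A}\mathbf{m}_B,\qquad \mathbf{x}_A=\sum_{B\leq A}u(B,A)\,\mathbf{p}_B .$$ -}

module Defs where

open import Data.Bool.Base using (Bool; true; false; T; if_then_else_)
import Data.Bool.Properties as Bool
import Data.Fin.Properties as Fin
open import Data.Fin.Induction using (spo-wellFounded)
open import Data.Fin.Subset
  using (Subset; inside; outside; _∈_; _⊆_; _∩_; _∪_; Nonempty; Empty)
open import Data.Fin.Subset.Properties
  using (_∈?_; nonempty?; anySubset?; ⊆-antisym; x∈p∩q⁺; x∈p∩q⁻; x∈p∪q⁺; x∈p∪q⁻)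
open import Data.List.Base
  using (List; []; _∷_; map; foldr; filter; cartesianProduct; lookup)
import Data.List.Membership.Propositional as List
open import Data.List.Membership.Propositional.Properties
  using (∈-cartesianProduct⁺)
open import Data.List.Relation.Unary.All as All using (All; []; _∷_)
import Data.List.Relation.Unary.All.Properties as All
open import Data.List.Relation.Unary.AllPairs using ([]; _∷_)
open import Data.List.Relation.Unary.Any using (here; there; index)
open import Data.List.Relation.Unary.Any.Properties using (lookup-index)
open import Data.List.Relation.Unary.Unique.Propositional using (Unique)
open import Data.List.Relation.Unary.Unique.Propositional.Properties
  using (cartesianProduct⁺)
open import Data.Nat.Base using (ℕ; zero; suc)
open import Data.Product.Base using (_×_; _,_; proj₁; proj₂; ∃)
import Data.Product.Properties as Product
open import Data.Rational.Base using (ℚ; 0ℚ; 1ℚ; _+_; _*_; -_)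
open import Data.Sum.Base using (_⊎_; inj₁; inj₂; [_,_]′)
import Data.Vec.Base as Vec
import Data.Vec.Properties as Vec
open import Function.Base using (_∘_; _on_)
open import Function.Bundles using (_⇔_; mk⇔; Equivalence)
open import Induction.WellFounded using (WellFounded; Acc; acc)
open import Level using (0ℓ)
open import Relation.Binary.Core using (Rel)
open import Relation.Binary.Definitions using (DecidableEquality)
open import Relation.Binary.PropositionalEquality
  using (_≡_; _≢_; refl; sym; cong; cong₂; subst; subst₂)
import Relation.Binary.PropositionalEquality as ≡
open import Relation.Binary.Structures using (IsDecPartialOrder)
import Relation.Binary.Construct.NonStrictToStrict as ToStrict
import Relation.Binary.Construct.On as On
open import Relation.Nullary using (Dec; yes; no; does; ¬_; contradiction)
open import Relation.Nullary.Decidable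
  using (map′; ¬?; _×-dec_; _⊎-dec_; _→-dec_; T?; recompute; decidable-stable;
         toWitness; fromWitness; ⌊_⌋)
open import Relation.Unary using (Pred; Decidable)

private
  variable
    n : ℕ
    X Y : Set

record Finite (X : Set) : Set where
  field
    _≟_      : DecidableEquality X
    elements : List X
    complete : ∀ x → x List.∈ elements
    unique   : Unique elements

open Finite {{...}} public

instance
  finite-Bool : Finite Bool
  finite-Bool = record
    { _≟_      = Bool._≟_
    ; elements = false ∷ true ∷ []
    ; complete = λ { false → here refl ; true → there (here refl) }
    ; unique   = ((λ ()) ∷ []) ∷ [] ∷ []
    }

  finite-× : {{Finite X}} → {{Finite Y}} → Finite (X × Y)
  finite-× = record
    { _≟_      = Product.≡-dec _≟_ _≟_
    ; elements = cartesianProduct elements elements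
    ; complete = λ (x , y) → ∈-cartesianProduct⁺ (complete x) (complete y)
    ; unique   = cartesianProduct⁺ unique unique
    }

-- A vector is its family of coordinates; vectors are compared with _≗_.
Vect : Set → Set
Vect X = X → ℚ

∑ : List X → (X → ℚ) → ℚ
∑ xs f = foldr _+_ 0ℚ (map f xs)

∑ᵥ : List X → (X → Vect Y) → Vect Y
∑ᵥ xs f y = ∑ xs (λ x → f x y)

0ᵥ : Vect X
0ᵥ _ = 0ℚ

infixr 7 _•_
_•_ : ℚ → Vect X → Vect X
(c • v) x = c * v x

basis : {{Finite X}} → X → Vect X
basis x y = if does (x ≟ y) then 1ℚ else 0ℚ

-- Vect (X × Y) is the tensor product of Vect X and Vect Y, with
-- basis (x , y) = basis x ⊗ basis y.
infixr 8 _⊗_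
_⊗_ : Vect X → Vect Y → Vect (X × Y)
(v ⊗ w) (x , y) = v x * w y

linear : {{Finite X}} → (X → Vect Y) → Vect X → Vect Y
linear f v = ∑ᵥ elements (λ x → v x • f x)

module Möbius {X : Set} {{_ : Finite X}} {_≤_ : Rel X 0ℓ}
              (isDecPartialOrder : IsDecPartialOrder _≡_ _≤_) where

  open IsDecPartialOrder isDecPartialOrder using (_≤?_; isPartialOrder)
  open ToStrict {A = X} _≡_ _≤_ using (_<_; <-decidable; <-isStrictPartialOrder)

  _<?_ : ∀ x y → Dec (x < y)
  _<?_ = <-decidable _≟_ _≤?_

  <-wellFounded : WellFounded _<_
  <-wellFounded x = go x (spo-wellFounded
      (On.isStrictPartialOrder (lookup elements) (<-isStrictPartialOrder isPartialOrder))
      (index (complete x)))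
    where
    go : ∀ x → Acc (_<_ on lookup elements) (index (complete x)) → Acc _<_ x
    go x (acc rs) = acc λ {y} y<x → go y (rs (subst₂ _<_
      (lookup-index (complete y)) (lookup-index (complete x)) y<x))

  -- μ(x,x) = 1;  μ(x,y) = - Σ_{x ≤ z < y} μ(x,z) for x < y;  0 if x ≰ y.
  möbius-acc : ∀ x y → Acc _<_ y → ℚ
  möbius-acc x y (acc rs) =
    if does (x ≟ y) then 1ℚ else
    if does (x ≤? y) then - ∑ elements term else 0ℚ
    where
    term : X → ℚ
    term z with x ≤? z | z <? y
    ... | yes _ | yes z<y = möbius-acc x z (rs z<y)
    ... | _     | _       = 0ℚ

  möbius : X → X → ℚ
  möbius x y = möbius-acc x y (<-wellFounded y)

-- A complete binary tree storing a function Subset n → Bool, so that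
-- collections with the same members are propositionally equal.
Collection : ℕ → Set
Collection zero    = Bool
Collection (suc n) = Collection n × Collection n

member : Collection n → Subset n → Bool
member b       Vec.[]              = b
member (𝒜 , _) (inside  Vec.∷ U) = member 𝒜 U
member (_ , ℬ) (outside Vec.∷ U) = member ℬ U

infix 4 _∈ᶜ_ _∈ᶜ?_
record _∈ᶜ_ (U : Subset n) (𝒜 : Collection n) : Set where
  constructor mem
  field isMember : T (member 𝒜 U)

open _∈ᶜ_ public

_∈ᶜ?_ : (U : Subset n) (𝒜 : Collection n) → Dec (U ∈ᶜ 𝒜)
U ∈ᶜ? 𝒜 = map′ mem isMember (T? (member 𝒜 U))

tabulate : (Subset n → Bool) → Collection n
tabulate {zero}  f = f Vec.[]
tabulate {suc n} f = tabulate (f ∘ (inside Vec.∷_)) , tabulate (f ∘ (outside Vec.∷_))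

member-tabulate : (f : Subset n → Bool) → ∀ U → member (tabulate f) U ≡ f U
member-tabulate f Vec.[]              = refl
member-tabulate f (inside  Vec.∷ U) = member-tabulate (f ∘ (inside Vec.∷_)) U
member-tabulate f (outside Vec.∷ U) = member-tabulate (f ∘ (outside Vec.∷_)) U

member-injective : {𝒜 ℬ : Collection n} → (∀ U → member 𝒜 U ≡ member ℬ U) → 𝒜 ≡ ℬ
member-injective {zero}  eq = eq Vec.[]
member-injective {suc n} eq = cong₂ _,_
  (member-injective (eq ∘ (inside Vec.∷_))) (member-injective (eq ∘ (outside Vec.∷_)))

⊆-antisymᶜ : {𝒜 ℬ : Collection n} →
  (∀ {U} → U ∈ᶜ 𝒜 → U ∈ᶜ ℬ) → (∀ {U} → U ∈ᶜ ℬ → U ∈ᶜ 𝒜) → 𝒜 ≡ ℬ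
⊆-antisymᶜ f g = member-injective λ U → Bool.⇔→≡ (mk⇔
  (λ eq → Equivalence.to Bool.T-≡ (isMember (f {U} (mem (Equivalence.from Bool.T-≡ eq)))))
  (λ eq → Equivalence.to Bool.T-≡ (isMember (g {U} (mem (Equivalence.from Bool.T-≡ eq))))))

comprehension : {P : Pred (Subset n) 0ℓ} → Decidable P → Collection n
comprehension P? = tabulate (λ U → ⌊ P? U ⌋)

module _ {P : Pred (Subset n) 0ℓ} (P? : Decidable P) {U : Subset n} where

  ∈-comprehension⁺ : P U → U ∈ᶜ comprehension P?
  ∈-comprehension⁺ p = mem (
    subst T (sym (member-tabulate (λ V → ⌊ P? V ⌋) U)) (fromWitness {a? = P? U} p))

  ∈-comprehension⁻ : U ∈ᶜ comprehension P? → P U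
  ∈-comprehension⁻ (mem q) =
    toWitness {a? = P? U} (subst T (member-tabulate (λ V → ⌊ P? V ⌋) U) q)

instance
  finite-Collection : Finite (Collection n)
  finite-Collection {zero}  = finite-Bool
  finite-Collection {suc n} = finite-× {{finite-Collection {n}}} {{finite-Collection {n}}}

-- Finite sets are the subsets of Fin n, for arbitrary n.
record IsPartition (S : Subset n) (𝒜 : Collection n) : Set where
  field
    nonempty : ∀ {U} → U ∈ᶜ 𝒜 → Nonempty U
    disjoint : ∀ {U V} → U ∈ᶜ 𝒜 → V ∈ᶜ 𝒜 → U ≢ V → Empty (U ∩ V)
    union    : ∀ x → x ∈ S ⇔ (∃ λ U → U ∈ᶜ 𝒜 × x ∈ U)

-- The proof is irrelevant: a set partition is determined by its blocks.
record SetPartition {n} (S : Subset n) : Set where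
  constructor _,_
  field
    blocks       : Collection n
    .isPartition : IsPartition S blocks

open SetPartition public

allSubset? : {P : Pred (Subset n) 0ℓ} → Decidable P → Dec (∀ U → P U)
allSubset? P? = map′
  (λ ¬∃¬ U → decidable-stable (P? U) (λ ¬p → ¬∃¬ (U , ¬p)))
  (λ ∀p (U , ¬p) → ¬p (∀p U))
  (¬? (anySubset? (¬? ∘ P?)))

_≟ˢ_ : DecidableEquality (Subset n)
_≟ˢ_ = Vec.≡-dec Bool._≟_

isPartition? : (S : Subset n) (𝒜 : Collection n) → Dec (IsPartition S 𝒜)
isPartition? S 𝒜 = map′
  (λ (ne , dj , to , from) → record
    { nonempty = ne _ ; disjoint = dj _ _ ; union = λ x → mk⇔ (to x) (from x) })
  (λ p → let open IsPartition p in
    (λ _ → nonempty) , (λ _ _ → disjoint) ,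
    (λ x → Equivalence.to (union x)) , (λ x → Equivalence.from (union x)))
  (allSubset? (λ U → (U ∈ᶜ? 𝒜) →-dec nonempty? U)
   ×-dec allSubset? (λ U → allSubset? λ V →
     (U ∈ᶜ? 𝒜) →-dec ((V ∈ᶜ? 𝒜) →-dec (¬? (U ≟ˢ V) →-dec ¬? (nonempty? (U ∩ V)))))
   ×-dec Fin.all? (λ x → (x ∈? S) →-dec covered? x)
   ×-dec Fin.all? (λ x → covered? x →-dec (x ∈? S)))
  where
  covered? : ∀ x → Dec (∃ λ U → U ∈ᶜ 𝒜 × x ∈ U)
  covered? x = anySubset? (λ U → (U ∈ᶜ? 𝒜) ×-dec (x ∈? U))

module _ {S : Subset n} where

  partition : (A : SetPartition S) → IsPartition S (blocks A)
  partition (𝒜 , p) = recompute (isPartition? S 𝒜) p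

  blocks-injective : {A B : SetPartition S} → blocks A ≡ blocks B → A ≡ B
  blocks-injective refl = refl

  partitionsAmong : List (Collection n) → List (SetPartition S)
  partitionsAmong []       = []
  partitionsAmong (𝒜 ∷ 𝒜s) with isPartition? S 𝒜
  ... | yes p = (𝒜 , p) ∷ partitionsAmong 𝒜s
  ... | no  _ = partitionsAmong 𝒜s

  private
    among-complete : ∀ A 𝒜s → blocks A List.∈ 𝒜s → A List.∈ partitionsAmong 𝒜s
    among-complete A (𝒜 ∷ 𝒜s) A∈ with isPartition? S 𝒜 | A∈
    ... | yes _ | here refl = here refl
    ... | yes _ | there A∈′ = there (among-complete A 𝒜s A∈′)
    ... | no ¬p | here refl = contradiction (partition A) ¬p
    ... | no _  | there A∈′ = among-complete A 𝒜s A∈′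

    among-all : {P : Pred (Collection n) 0ℓ} → ∀ {𝒜s} →
      All P 𝒜s → All (P ∘ blocks) (partitionsAmong 𝒜s)
    among-all [] = []
    among-all {𝒜s = 𝒜 ∷ _} (p ∷ ps) with isPartition? S 𝒜
    ... | yes _ = p ∷ among-all ps
    ... | no  _ = among-all ps

    among-unique : ∀ {𝒜s} → Unique 𝒜s → Unique (partitionsAmong 𝒜s)
    among-unique [] = []
    among-unique {𝒜 ∷ _} (𝒜∉ ∷ u) with isPartition? S 𝒜
    ... | yes _ = All.map (λ ≢ eq → ≢ (cong blocks eq)) (among-all 𝒜∉) ∷ among-unique u
    ... | no  _ = among-unique u

  instance
    finite-SetPartition : Finite (SetPartition S)
    finite-SetPartition = record
      { _≟_      = λ A B → map′ blocks-injective (cong blocks) (blocks A ≟ blocks B)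
      ; elements = partitionsAmong elements
      ; complete = λ A → among-complete A elements (complete (blocks A))
      ; unique   = among-unique unique
      }

partitions : (S : Subset n) → List (SetPartition S)
partitions S = elements

module _ {S : Subset n} where

  infix 4 _≤_ _≤?_
  _≤_ : Rel (SetPartition S) 0ℓ
  B ≤ A = ∀ U → U ∈ᶜ blocks B → ∃ λ V → V ∈ᶜ blocks A × U ⊆ V

  _⊆?_ : (U V : Subset n) → Dec (U ⊆ V)
  U ⊆? V = map′ (λ f {x} → f x) (λ f x → f {x})
    (Fin.all? (λ x → (x ∈? U) →-dec (x ∈? V)))

  _≤?_ : ∀ B A → Dec (B ≤ A)
  B ≤? A = allSubset? λ U → (U ∈ᶜ? blocks B) →-dec
    anySubset? (λ V → (V ∈ᶜ? blocks A) ×-dec (U ⊆? V))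

  private
    nested⇒≡ : ∀ (A : SetPartition S) {U V} →
      U ∈ᶜ blocks A → V ∈ᶜ blocks A → U ⊆ V → U ≡ V
    nested⇒≡ A {U} {V} U∈ V∈ U⊆V = decidable-stable (U ≟ˢ V) λ U≢V →
      let (x , x∈U) = nonempty U∈ in
      disjoint U∈ V∈ U≢V (x , x∈p∩q⁺ (x∈U , U⊆V x∈U))
      where open IsPartition (partition A)

    blocks-⊆ : ∀ {A B : SetPartition S} → A ≤ B → B ≤ A →
      ∀ {U} → U ∈ᶜ blocks A → U ∈ᶜ blocks B
    blocks-⊆ {A} {B} A≤B B≤A {U} U∈A
      with V , V∈B , U⊆V ← A≤B U U∈A
      with W , W∈A , V⊆W ← B≤A V V∈B
      with refl ← nested⇒≡ A U∈A W∈A (V⊆W ∘ U⊆V)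
      = subst (_∈ᶜ blocks B) (⊆-antisym V⊆W U⊆V) V∈B

  ≤-isDecPartialOrder : IsDecPartialOrder _≡_ _≤_
  ≤-isDecPartialOrder = record
    { isPartialOrder = record
      { isPreorder = record
        { isEquivalence = ≡.isEquivalence
        ; reflexive     = λ { refl U U∈ → U , U∈ , λ x∈ → x∈ }
        ; trans         = λ A≤B B≤C U U∈ →
            let (V , V∈ , U⊆V) = A≤B U U∈
                (W , W∈ , V⊆W) = B≤C V V∈
            in W , W∈ , λ x∈ → V⊆W (U⊆V x∈)
        }
      ; antisym = λ {A} {B} A≤B B≤A → blocks-injective
          (⊆-antisymᶜ (blocks-⊆ {A} {B} A≤B B≤A) (blocks-⊆ {B} {A} B≤A A≤B))
      }
    ; _≟_  = _≟_
    ; _≤?_ = _≤?_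
    }

  u : SetPartition S → SetPartition S → ℚ
  u = Möbius.möbius ≤-isDecPartialOrder

record Decomposition {n} (S S₁ S₂ : Subset n) : Set where
  field
    disjoint : Empty (S₁ ∩ S₂)
    union    : S₁ ∪ S₂ ≡ S

  left : S₁ ⊆ S
  left {x} x∈ = subst (x ∈_) union (x∈p∪q⁺ (inj₁ x∈))

  right : S₂ ⊆ S
  right {x} x∈ = subst (x ∈_) union (x∈p∪q⁺ (inj₂ x∈))

restrictBlock? : (𝒜 : Collection n) (R U : Subset n) →
  Dec (Nonempty U × ∃ λ V → V ∈ᶜ 𝒜 × U ≡ V ∩ R)
restrictBlock? 𝒜 R U =
  nonempty? U ×-dec anySubset? (λ V → (V ∈ᶜ? 𝒜) ×-dec (U ≟ˢ (V ∩ R)))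

restrictBlocks : Collection n → Subset n → Collection n
restrictBlocks 𝒜 R = comprehension (restrictBlock? 𝒜 R)

restrict-isPartition : {S R : Subset n} {𝒜 : Collection n} →
  R ⊆ S → IsPartition S 𝒜 → IsPartition R (restrictBlocks 𝒜 R)
restrict-isPartition {R = R} {𝒜} R⊆S p = record
  { nonempty = proj₁ ∘ un
  ; disjoint = λ U∈ V∈ → disj (proj₂ (un U∈)) (proj₂ (un V∈))
  ; union    = λ x → mk⇔
      (λ x∈R → let (V , V∈ , x∈V) = Equivalence.to (union x) (R⊆S x∈R)
                   x∈∩ = x∈p∩q⁺ (x∈V , x∈R)
               in V ∩ R , ∈-comprehension⁺ (restrictBlock? 𝒜 R) ((x , x∈∩) , V , V∈ , refl) , x∈∩)
      (λ { (U , U∈ , x∈U) → inR (proj₂ (un U∈)) x∈U })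
  }
  where
  open IsPartition p
  un : ∀ {U} → U ∈ᶜ restrictBlocks 𝒜 R → Nonempty U × ∃ λ V → V ∈ᶜ 𝒜 × U ≡ V ∩ R
  un = ∈-comprehension⁻ (restrictBlock? 𝒜 R)
  inR : ∀ {U x} → (∃ λ V → V ∈ᶜ 𝒜 × U ≡ V ∩ R) → x ∈ U → x ∈ R
  inR (V , _ , refl) x∈ = proj₂ (x∈p∩q⁻ V R x∈)
  disj : ∀ {U V} → (∃ λ U′ → U′ ∈ᶜ 𝒜 × U ≡ U′ ∩ R) → (∃ λ V′ → V′ ∈ᶜ 𝒜 × V ≡ V′ ∩ R) →
    U ≢ V → Empty (U ∩ V)
  disj (U′ , U′∈ , refl) (V′ , V′∈ , refl) U≢V (x , x∈) =
    let (x∈U , x∈V) = x∈p∩q⁻ _ _ x∈ in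
    disjoint U′∈ V′∈ (λ { refl → U≢V refl })
      (x , x∈p∩q⁺ (proj₁ (x∈p∩q⁻ U′ R x∈U) , proj₁ (x∈p∩q⁻ V′ R x∈V)))

restrict : {S R : Subset n} → .(R ⊆ S) → SetPartition S → SetPartition R
restrict {R = R} R⊆S (𝒜 , p) = restrictBlocks 𝒜 R , restrict-isPartition R⊆S p

unionBlock? : (𝒜 ℬ : Collection n) (U : Subset n) → Dec (U ∈ᶜ 𝒜 ⊎ U ∈ᶜ ℬ)
unionBlock? 𝒜 ℬ U = (U ∈ᶜ? 𝒜) ⊎-dec (U ∈ᶜ? ℬ)

unionBlocks : Collection n → Collection n → Collection n
unionBlocks 𝒜 ℬ = comprehension (unionBlock? 𝒜 ℬ)

union-isPartition : {S S₁ S₂ : Subset n} {𝒜 ℬ : Collection n} →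
  Decomposition S S₁ S₂ → IsPartition S₁ 𝒜 → IsPartition S₂ ℬ →
  IsPartition S (unionBlocks 𝒜 ℬ)
union-isPartition {S = S} {S₁} {S₂} {𝒜} {ℬ} d p q = record
  { nonempty = [ P.nonempty , Q.nonempty ]′ ∘ un
  ; disjoint = λ U∈ V∈ → disj (un U∈) (un V∈)
  ; union    = λ x → mk⇔
      (λ x∈S → [ (λ x∈ → let (U , U∈ , x∈U) = Equivalence.to (P.union x) x∈
                         in U , mk (inj₁ U∈) , x∈U)
               , (λ x∈ → let (U , U∈ , x∈U) = Equivalence.to (Q.union x) x∈
                         in U , mk (inj₂ U∈) , x∈U)
               ]′ (x∈p∪q⁻ S₁ S₂ (subst (x ∈_) (sym D.union) x∈S)))
      (λ (U , U∈ , x∈U) →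
        [ (λ U∈𝒜 → D.left  (Equivalence.from (P.union x) (U , U∈𝒜 , x∈U)))
        , (λ U∈ℬ → D.right (Equivalence.from (Q.union x) (U , U∈ℬ , x∈U)))
        ]′ (un U∈))
  }
  where
  module D = Decomposition d
  module P = IsPartition p
  module Q = IsPartition q
  un : ∀ {U} → U ∈ᶜ unionBlocks 𝒜 ℬ → U ∈ᶜ 𝒜 ⊎ U ∈ᶜ ℬ
  un = ∈-comprehension⁻ (unionBlock? 𝒜 ℬ)
  mk : ∀ {U} → U ∈ᶜ 𝒜 ⊎ U ∈ᶜ ℬ → U ∈ᶜ unionBlocks 𝒜 ℬ
  mk = ∈-comprehension⁺ (unionBlock? 𝒜 ℬ)
  cross : ∀ {U V x} → U ∈ᶜ 𝒜 → V ∈ᶜ ℬ → x ∈ U → ¬ x ∈ V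
  cross {U} {V} {x} U∈ V∈ x∈U x∈V = D.disjoint (x , x∈p∩q⁺
    (Equivalence.from (P.union x) (U , U∈ , x∈U) , Equivalence.from (Q.union x) (V , V∈ , x∈V)))
  disj : ∀ {U V} → U ∈ᶜ 𝒜 ⊎ U ∈ᶜ ℬ → V ∈ᶜ 𝒜 ⊎ V ∈ᶜ ℬ → U ≢ V → Empty (U ∩ V)
  disj (inj₁ U∈) (inj₁ V∈) = P.disjoint U∈ V∈
  disj (inj₂ U∈) (inj₂ V∈) = Q.disjoint U∈ V∈
  disj {U} {V} (inj₁ U∈) (inj₂ V∈) _ (x , x∈) =
    let (x∈U , x∈V) = x∈p∩q⁻ U V x∈ in cross U∈ V∈ x∈U x∈V
  disj {U} {V} (inj₂ U∈) (inj₁ V∈) _ (x , x∈) =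
    let (x∈U , x∈V) = x∈p∩q⁻ U V x∈ in cross V∈ U∈ x∈V x∈U

disjointUnion : {S S₁ S₂ : Subset n} → .(Decomposition S S₁ S₂) →
  SetPartition S₁ → SetPartition S₂ → SetPartition S
disjointUnion d (𝒜 , p) (ℬ , q) = unionBlocks 𝒜 ℬ , union-isPartition d p q

𝚷 : Subset n → Set
𝚷 S = Vect (SetPartition S)

𝚷⊗𝚷 : Subset n → Subset n → Set
𝚷⊗𝚷 S₁ S₂ = Vect (SetPartition S₁ × SetPartition S₂)

module _ {S : Subset n} where

  𝐦 𝐩 𝐱 : SetPartition S → 𝚷 S
  𝐦 A = basis A
  𝐩 A = ∑ᵥ (filter (λ B → A ≤? B) (partitions S)) 𝐦
  𝐱 A = ∑ᵥ (filter (λ B → B ≤? A) (partitions S)) (λ B → u B A • 𝐩 B)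

module _ {S S₁ S₂ : Subset n} (d : Decomposition S S₁ S₂) where

  open Decomposition d using (left; right)

  restrict₁ : SetPartition S → SetPartition S₁
  restrict₁ = restrict left

  restrict₂ : SetPartition S → SetPartition S₂
  restrict₂ = restrict right

  Splits : SetPartition S → Set
  Splits A = A ≡ disjointUnion d (restrict₁ A) (restrict₂ A)

  splits? : Decidable Splits
  splits? A = A ≟ disjointUnion d (restrict₁ A) (restrict₂ A)

  μ : 𝚷⊗𝚷 S₁ S₂ → 𝚷 S
  μ = linear λ (A , B) →
    ∑ᵥ (filter (λ C → (restrict₁ C ≟ A) ×-dec (restrict₂ C ≟ B)) (partitions S)) 𝐦

  Δ : 𝚷 S → 𝚷⊗𝚷 S₁ S₂
  Δ = linear λ A →
    if does (splits? A) then 𝐦 (restrict₁ A) ⊗ 𝐦 (restrict₂ A) else 0ᵥ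

  c : SetPartition S → SetPartition S₁ → SetPartition S₂ → ℚ
  c A B C = ∑ (filter (λ D → splits? D ×-dec (D ≤? A)
                              ×-dec (B ≤? restrict₁ D) ×-dec (C ≤? restrict₂ D))
                      (partitions S))
              (λ D → u D A)

{-# OPTIONS --safe #-}

-- In the m-basis both structure maps are substitutions of coordinates:
-- μ(v) at C is v at (C|S₁ , C|S₂), and Δ(v) at (E , F) is v at E ⊔ F.  Möbius
-- inversion gives p_A = Σ_{B ≤ A} x_B, and p_A at C is the indicator of A ≤ C.
-- (1) Summed over A′ ≤ A and B′ ≤ B, both sides give p_{A ⊔ B}, because the
-- ideal below A ⊔ B is the product of the ideals below A and B; sums over
-- principal ideals determine a function.
-- (2) Expand x_A in the p_D and use that D ≤ E ⊔ F holds iff D splits,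
-- D|S₁ ≤ E and D|S₂ ≤ F, so that Δ(p_D) is p_{D|S₁} ⊗ p_{D|S₂} or 0.

module Submission where

open import Defs
open import Data.Nat.Base using (ℕ)
open import Data.Fin.Subset using (Subset; _∈_; _⊆_; _∩_; Nonempty)
open import Data.Fin.Subset.Properties
  using (⊆-antisym; ∩-comm; ∪-comm; x∈p∩q⁺; x∈p∩q⁻)
open import Data.Bool.Base using (if_then_else_)
open import Data.List.Base using (List; []; _∷_; filter)
open import Data.List.Membership.Propositional using () renaming (_∈_ to _∈ₗ_)
import Data.List.Relation.Unary.All as All
open import Data.List.Relation.Unary.AllPairs using ([]; _∷_)
open import Data.List.Relation.Unary.Any using (here; there)
open import Data.List.Relation.Unary.Unique.Propositional using (Unique)
open import Data.Product.Base using (Σ-syntax; ∃; _×_; _,_; proj₁; proj₂)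
open import Data.Rational.Base using (ℚ; 0ℚ; 1ℚ; _+_; _*_; -_)
open import Data.Rational.Properties
  using (+-identityˡ; +-identityʳ; +-inverseˡ; *-identityˡ; *-zeroˡ; *-zeroʳ;
         *-assoc; *-comm; *-distribˡ-+; +-0-group; +-0-commutativeMonoid;
         *-1-commutativeMonoid)
open import Data.Rational.Solver using (module +-*-Solver)
open import Algebra.Bundles using (CommutativeMonoid)
open import Algebra.Properties.CommutativeSemigroup
  (CommutativeMonoid.commutativeSemigroup +-0-commutativeMonoid)
  using () renaming (interchange to +-interchange)
open import Algebra.Properties.CommutativeSemigroup
  (CommutativeMonoid.commutativeSemigroup *-1-commutativeMonoid)
  using () renaming (x∙yz≈y∙xz to x*yz≡y*xz)
open import Algebra.Properties.Group +-0-group using () renaming (∙-cancelʳ to +-cancelʳ)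
open import Data.Sum.Base as Sum using (_⊎_; inj₁; inj₂; [_,_]′)
open import Function.Base using (_∘_)
open import Function.Bundles using (Equivalence)
open import Induction.WellFounded using (Acc; acc)
open import Level using (0ℓ)
open import Relation.Binary.Core using (Rel)
import Relation.Binary.Construct.NonStrictToStrict as ToStrict
open import Relation.Binary.PropositionalEquality
  using (_≡_; _≢_; _≗_; refl; sym; trans; cong; cong₂; subst; module ≡-Reasoning)
open import Relation.Binary.Structures using (IsDecPartialOrder)
open import Relation.Nullary using (Dec; yes; no; does; ¬_; contradiction)
open import Relation.Nullary.Decidable using (_×-dec_)
open import Relation.Unary using (Pred; Decidable)

open ≡-Reasoning
open +-*-Solver using (solve; _:*_; _:=_)

private
  variable
    n : ℕ
    P Q X Y : Set

-- Indicators of decidable propositions.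

⟦_⟧ : Dec P → ℚ
⟦ P? ⟧ = if does P? then 1ℚ else 0ℚ

⟦⟧-yes : (P? : Dec P) → P → ⟦ P? ⟧ ≡ 1ℚ
⟦⟧-yes (yes _) _ = refl
⟦⟧-yes (no ¬p) p = contradiction p ¬p

⟦⟧-no : (P? : Dec P) → ¬ P → ⟦ P? ⟧ ≡ 0ℚ
⟦⟧-no (yes p) ¬p = contradiction p ¬p
⟦⟧-no (no _)  _  = refl

⟦⟧-⇔ : (P? : Dec P) (Q? : Dec Q) → (P → Q) → (Q → P) → ⟦ P? ⟧ ≡ ⟦ Q? ⟧
⟦⟧-⇔ (yes p) Q? f g = sym (⟦⟧-yes Q? (f p))
⟦⟧-⇔ (no ¬p) Q? f g = sym (⟦⟧-no Q? (¬p ∘ g))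

⟦⟧-× : (P? : Dec P) (Q? : Dec Q) → ⟦ P? ×-dec Q? ⟧ ≡ ⟦ P? ⟧ * ⟦ Q? ⟧
⟦⟧-× (yes _) Q? = sym (*-identityˡ ⟦ Q? ⟧)
⟦⟧-× (no _)  Q? = sym (*-zeroˡ ⟦ Q? ⟧)

⟦⟧-×₃ : ∀ {R : Set} (P? : Dec P) (Q? : Dec Q) (R? : Dec R) →
  ⟦ P? ×-dec (Q? ×-dec R?) ⟧ ≡ ⟦ P? ⟧ * (⟦ Q? ⟧ * ⟦ R? ⟧)
⟦⟧-×₃ P? Q? R? = trans (⟦⟧-× P? (Q? ×-dec R?)) (cong (⟦ P? ⟧ *_) (⟦⟧-× Q? R?))

*-assoc₄ : ∀ a b c d → a * (b * (c * d)) ≡ (a * (b * c)) * d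
*-assoc₄ a b c d = trans (cong (a *_) (sym (*-assoc b c d))) (sym (*-assoc a (b * c) d))

-- Inside a sum this makes the condition on the index available as a hypothesis, as an induction
-- over a strict order requires.
⟦⟧-*-cong : ∀ (P? : Dec P) {a b} → (P → a ≡ b) → ⟦ P? ⟧ * a ≡ ⟦ P? ⟧ * b
⟦⟧-*-cong (yes p) eq = cong (1ℚ *_) (eq p)
⟦⟧-*-cong (no _) {a} {b} _ = trans (*-zeroˡ a) (sym (*-zeroˡ b))

⟦⟧-*-no : ∀ (P? : Dec P) a → ¬ P → ⟦ P? ⟧ * a ≡ 0ℚ
⟦⟧-*-no P? a ¬p = trans (cong (_* a) (⟦⟧-no P? ¬p)) (*-zeroˡ a)

⟦⟧-*-yes : ∀ (P? : Dec P) a → P → ⟦ P? ⟧ * a ≡ a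
⟦⟧-*-yes P? a p = trans (cong (_* a) (⟦⟧-yes P? p)) (*-identityˡ a)

-- Finite sums over lists.

∑-cong : ∀ (xs : List X) {f g} → f ≗ g → ∑ xs f ≡ ∑ xs g
∑-cong []       eq = refl
∑-cong (x ∷ xs) eq = cong₂ _+_ (eq x) (∑-cong xs eq)

∑-zero : ∀ (xs : List X) {f} → (∀ {x} → x ∈ₗ xs → f x ≡ 0ℚ) → ∑ xs f ≡ 0ℚ
∑-zero []       eq = refl
∑-zero (x ∷ xs) eq =
  trans (cong₂ _+_ (eq (here refl)) (∑-zero xs (eq ∘ there))) (+-identityˡ 0ℚ)

∑-+ : ∀ (xs : List X) f g → ∑ xs (λ x → f x + g x) ≡ ∑ xs f + ∑ xs g
∑-+ []       f g = refl
∑-+ (x ∷ xs) f g =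
  trans (cong (f x + g x +_) (∑-+ xs f g)) (+-interchange (f x) (g x) (∑ xs f) (∑ xs g))

*-distribˡ-∑ : ∀ (xs : List X) a f → a * ∑ xs f ≡ ∑ xs (λ x → a * f x)
*-distribˡ-∑ []       a f = *-zeroʳ a
*-distribˡ-∑ (x ∷ xs) a f =
  trans (*-distribˡ-+ a (f x) (∑ xs f)) (cong (a * f x +_) (*-distribˡ-∑ xs a f))

*-distribʳ-∑ : ∀ (xs : List X) a f → ∑ xs f * a ≡ ∑ xs (λ x → f x * a)
*-distribʳ-∑ xs a f = trans (*-comm (∑ xs f) a)
  (trans (*-distribˡ-∑ xs a f) (∑-cong xs (λ x → *-comm a (f x))))

∑-swap : ∀ (xs : List X) (ys : List Y) (f : X → Y → ℚ) →
  ∑ xs (λ x → ∑ ys (f x)) ≡ ∑ ys (λ y → ∑ xs (λ x → f x y))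
∑-swap []       ys f = sym (∑-zero ys (λ _ → refl))
∑-swap (x ∷ xs) ys f = trans (cong (∑ ys (f x) +_) (∑-swap xs ys f))
  (sym (∑-+ ys (f x) (λ y → ∑ xs (λ x′ → f x′ y))))

∑-*-∑ : ∀ (xs : List X) (ys : List Y) f g →
  ∑ xs f * ∑ ys g ≡ ∑ xs (λ x → ∑ ys (λ y → f x * g y))
∑-*-∑ xs ys f g = trans (*-distribʳ-∑ xs (∑ ys g) f)
  (∑-cong xs (λ x → *-distribˡ-∑ ys (f x) g))

-- With conditions turned into factors, every sum runs over a fixed full list, and sums can be
-- exchanged even when the condition on one index involves the other.
∑-filter : ∀ {P : Pred X 0ℓ} (P? : Decidable P) xs f →
  ∑ (filter P? xs) f ≡ ∑ xs (λ x → ⟦ P? x ⟧ * f x)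
∑-filter P? []       f = refl
∑-filter P? (x ∷ xs) f with P? x
... | yes _ = cong₂ _+_ (sym (*-identityˡ (f x))) (∑-filter P? xs f)
... | no _  = trans (∑-filter P? xs f)
  (sym (trans (cong (_+ _) (*-zeroˡ (f x))) (+-identityˡ _)))

-- Uniqueness of `xs` guarantees that `y` is counted once: the entries before and after it differ
-- from `y` and contribute zero.
∑-point : ∀ {xs : List X} {y f} → Unique xs → y ∈ₗ xs →
  (∀ {x} → x ≢ y → f x ≡ 0ℚ) → ∑ xs f ≡ f y
∑-point {xs = y ∷ xs} {f = f} (y∉ ∷ _) (here refl) eq =
  trans (cong (f y +_) (∑-zero xs (λ x∈ → eq (All.lookup y∉ x∈ ∘ sym))))
        (+-identityʳ (f y))
∑-point {y = y} {f} (x∉ ∷ uniq) (there y∈) eq =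
  trans (cong₂ _+_ (eq (All.lookup x∉ y∈)) (∑-point uniq y∈ eq)) (+-identityˡ (f y))

module _ {{_ : Finite X}} where

  -- Stated for any predicate with `y` as its only solution, since `μ-coordinate` selects a pair by
  -- two equations on restrictions.
  ∑-δ : ∀ {P : Pred X 0ℓ} (P? : Decidable P) y (f : X → ℚ) →
    P y → (∀ {x} → P x → x ≡ y) → ∑ elements (λ x → ⟦ P? x ⟧ * f x) ≡ f y
  ∑-δ P? y f py ≡y = trans
    (∑-point unique (complete y) (λ {x} x≢y → ⟦⟧-*-no (P? x) (f x) (x≢y ∘ ≡y)))
    (⟦⟧-*-yes (P? y) (f y) py)

  ∑-filter-basis : ∀ {P : Pred X 0ℓ} (P? : Decidable P) y →
    ∑ᵥ (filter P? elements) basis y ≡ ⟦ P? y ⟧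
  ∑-filter-basis P? y = begin
    ∑ (filter P? elements) (λ x → basis x y)     ≡⟨ ∑-filter P? elements _ ⟩
    ∑ elements (λ x → ⟦ P? x ⟧ * ⟦ x ≟ y ⟧)      ≡⟨ ∑-cong elements (λ x → *-comm ⟦ P? x ⟧ _) ⟩
    ∑ elements (λ x → ⟦ x ≟ y ⟧ * ⟦ P? x ⟧)      ≡⟨ ∑-δ (_≟ y) y _ refl (λ eq → eq) ⟩
    ⟦ P? y ⟧                                     ∎

-- Möbius inversion on a finite poset.

module MöbiusInversion {X : Set} {{_ : Finite X}} {_⊑_ : Rel X 0ℓ}
                       (isDecPartialOrder : IsDecPartialOrder _≡_ _⊑_) where

  open IsDecPartialOrder isDecPartialOrder
    using () renaming (_≤?_ to _⊑?_; refl to ⊑-refl; trans to ⊑-trans; antisym to ⊑-antisym)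
  open ToStrict {A = X} _≡_ _⊑_ using (_<_)
  open Möbius isDecPartialOrder

  ∑-≤-split : ∀ y f → ∑ elements (λ x → ⟦ x ⊑? y ⟧ * f x)
                    ≡ f y + ∑ elements (λ x → ⟦ x <? y ⟧ * f x)
  ∑-≤-split y f = begin
    ∑ elements (λ x → ⟦ x ⊑? y ⟧ * f x)
      ≡⟨ ∑-cong elements split ⟩
    ∑ elements (λ x → ⟦ x ≟ y ⟧ * f x + ⟦ x <? y ⟧ * f x)
      ≡⟨ ∑-+ elements (λ x → ⟦ x ≟ y ⟧ * f x) (λ x → ⟦ x <? y ⟧ * f x) ⟩
    ∑ elements (λ x → ⟦ x ≟ y ⟧ * f x) + ∑ elements (λ x → ⟦ x <? y ⟧ * f x)
      ≡⟨ cong (_+ ∑ elements (λ x → ⟦ x <? y ⟧ * f x)) (∑-δ (_≟ y) y f refl (λ eq → eq)) ⟩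
    f y + ∑ elements (λ x → ⟦ x <? y ⟧ * f x) ∎
    where
    split : ∀ x → ⟦ x ⊑? y ⟧ * f x ≡ ⟦ x ≟ y ⟧ * f x + ⟦ x <? y ⟧ * f x
    split x = cases (x ≟ y)
      where
      cases : Dec (x ≡ y) → ⟦ x ⊑? y ⟧ * f x ≡ ⟦ x ≟ y ⟧ * f x + ⟦ x <? y ⟧ * f x
      cases (yes refl) = trans (⟦⟧-*-yes (x ⊑? x) (f x) ⊑-refl) (sym (trans
        (cong₂ _+_ (⟦⟧-*-yes (x ≟ x) (f x) refl)
                   (⟦⟧-*-no (x <? x) (f x) λ (_ , x≢x) → x≢x refl))
        (+-identityʳ (f x))))
      cases (no x≢y) = trans
        (cong (_* f x) (⟦⟧-⇔ (x ⊑? y) (x <? y) (_, x≢y) proj₁))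
        (sym (trans (cong (_+ ⟦ x <? y ⟧ * f x) (⟦⟧-*-no (x ≟ y) (f x) x≢y)) (+-identityˡ _)))

  -- By well-founded induction the terms strictly below `y` agree; cancelling them from the two sums
  -- leaves the terms at `y`.
  ∑-≤-injective : ∀ {f g : X → ℚ} →
    (∀ y → ∑ elements (λ x → ⟦ x ⊑? y ⟧ * f x) ≡ ∑ elements (λ x → ⟦ x ⊑? y ⟧ * g x)) →
    f ≗ g
  ∑-≤-injective {f} {g} eq y = go y (<-wellFounded y)
    where
    go : ∀ y → Acc _<_ y → f y ≡ g y
    go y (acc rs) = +-cancelʳ (∑ elements (λ x → ⟦ x <? y ⟧ * f x)) (f y) (g y) (begin
      f y + ∑ elements (λ x → ⟦ x <? y ⟧ * f x) ≡⟨ ∑-≤-split y f ⟨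
      ∑ elements (λ x → ⟦ x ⊑? y ⟧ * f x)       ≡⟨ eq y ⟩
      ∑ elements (λ x → ⟦ x ⊑? y ⟧ * g x)       ≡⟨ ∑-≤-split y g ⟩
      g y + ∑ elements (λ x → ⟦ x <? y ⟧ * g x)
        ≡⟨ cong (g y +_) (∑-cong elements λ x → ⟦⟧-*-cong (x <? y) λ x<y → go x (rs x<y)) ⟨
      g y + ∑ elements (λ x → ⟦ x <? y ⟧ * f x) ∎)

  -- The summand in the definition of möbius-acc is local to it and cannot be
  -- named; unification recovers it.
  möbius-acc-unfold : ∀ x y (rs : ∀ {z} → z < y → Acc _<_ z) →
    Σ[ t ∈ (X → ℚ) ] möbius-acc x y (acc rs) ≡
      (if does (x ≟ y) then 1ℚ else if does (x ⊑? y) then - ∑ elements t else 0ℚ)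
  möbius-acc-unfold x y rs = _ , refl

  -- Matching on the same two decisions as the hidden summand makes it compute. The function `f`
  -- stands for values below `y` that no longer mention an accessibility proof.
  möbius-acc-term : ∀ x y (rs : ∀ {z} → z < y → Acc _<_ z) (f : X → ℚ) →
    (∀ z (z<y : z < y) → möbius-acc x z (rs z<y) ≡ f z) →
    ∀ z → proj₁ (möbius-acc-unfold x y rs) z ≡ ⟦ z <? y ⟧ * (⟦ x ⊑? z ⟧ * f z)
  möbius-acc-term x y rs f eq z with x ⊑? z | z <? y
  ... | yes _ | yes z<y =
    trans (eq z z<y) (sym (trans (⟦⟧-*-yes (z <? y) _ z<y) (*-identityˡ (f z))))
  ... | yes _ | no z≮y  = sym (⟦⟧-*-no (z <? y) _ z≮y)
  ... | no _  | yes z<y = sym (trans (⟦⟧-*-yes (z <? y) _ z<y) (*-zeroˡ (f z)))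
  ... | no _  | no z≮y  = sym (⟦⟧-*-no (z <? y) _ z≮y)

  möbius-acc-rec : ∀ x y (rs : ∀ {z} → z < y → Acc _<_ z) (f : X → ℚ) →
    (∀ z (z<y : z < y) → möbius-acc x z (rs z<y) ≡ f z) →
    möbius-acc x y (acc rs) ≡
      (if does (x ≟ y) then 1ℚ else if does (x ⊑? y)
        then - ∑ elements (λ z → ⟦ z <? y ⟧ * (⟦ x ⊑? z ⟧ * f z)) else 0ℚ)
  möbius-acc-rec x y rs f eq = trans (proj₂ (möbius-acc-unfold x y rs))
    (cong (λ s → if does (x ≟ y) then 1ℚ else if does (x ⊑? y) then - s else 0ℚ)
      (∑-cong elements (möbius-acc-term x y rs f eq)))

  möbius-acc-irrelevant : ∀ x y (p q : Acc _<_ y) → möbius-acc x y p ≡ möbius-acc x y q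
  möbius-acc-irrelevant x y (acc rs) (acc rs′) = trans
    (möbius-acc-rec x y rs (möbius x) λ z z<y → möbius-acc-irrelevant x z (rs z<y) (<-wellFounded z))
    -- The detour through `rs z<y` makes the first accessibility proof structurally smaller in every
    -- recursive call.
    (sym (möbius-acc-rec x y rs′ (möbius x) λ z z<y → trans
      (sym (möbius-acc-irrelevant x z (rs z<y) (rs′ z<y)))
      (möbius-acc-irrelevant x z (rs z<y) (<-wellFounded z))))

  möbius-rec : ∀ x y → möbius x y ≡
    (if does (x ≟ y) then 1ℚ else if does (x ⊑? y)
      then - ∑ elements (λ z → ⟦ z <? y ⟧ * (⟦ x ⊑? z ⟧ * möbius x z)) else 0ℚ)
  möbius-rec x y = trans
    -- An explicit `acc` replaces `<-wellFounded y` so that the recursion unfolds; its predecessors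
    -- are chosen so that the values below `y` are `möbius x z` by definition.
    (möbius-acc-irrelevant x y (<-wellFounded y) (acc λ {z} _ → <-wellFounded z))
    (möbius-acc-rec x y (λ {z} _ → <-wellFounded z) (möbius x) λ _ _ → refl)

  -- For `x < y` the recursion makes the term at `y` the negative of the rest. Otherwise no `z < y`
  -- lies above `x`, so the rest vanishes and only the term at `y` is left.
  ∑-möbius : ∀ x y →
    ∑ elements (λ z → ⟦ z ⊑? y ⟧ * (⟦ x ⊑? z ⟧ * möbius x z)) ≡ ⟦ x ≟ y ⟧
  ∑-möbius x y = trans (∑-≤-split y (λ z → ⟦ x ⊑? z ⟧ * möbius x z)) telescope
    where
    rest : ℚ
    rest = ∑ elements (λ z → ⟦ z <? y ⟧ * (⟦ x ⊑? z ⟧ * möbius x z))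

    below : ¬ x < y → rest ≡ 0ℚ
    below x≮y = ∑-zero elements λ {z} _ → trans
      (⟦⟧-*-cong (z <? y) λ (z⊑y , z≢y) → ⟦⟧-*-no (x ⊑? z) (möbius x z) λ x⊑z →
        x≮y (⊑-trans x⊑z z⊑y , λ { refl → z≢y (⊑-antisym z⊑y x⊑z) }))
      (*-zeroʳ ⟦ z <? y ⟧)

    telescope : ⟦ x ⊑? y ⟧ * möbius x y + rest ≡ ⟦ x ≟ y ⟧
    -- The recursion equation is abstracted together with the two decisions, so that its
    -- conditionals reduce in each case.
    telescope with x ≟ y | x ⊑? y | möbius-rec x y
    ... | yes refl | yes _   | eq =
      cong₂ _+_ (trans (*-identityˡ (möbius x x)) eq) (below λ (_ , x≢x) → x≢x refl)
    ... | yes refl | no x⋢x  | eq = contradiction ⊑-refl x⋢x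
    ... | no _     | yes _   | eq = trans
      (cong (_+ rest) (trans (*-identityˡ (möbius x y)) eq)) (+-inverseˡ rest)
    ... | no _     | no x⋢y  | eq = trans
      (cong₂ _+_ (*-zeroˡ (möbius x y)) (below (x⋢y ∘ proj₁))) (+-identityˡ 0ℚ)

-- Blocks, restriction and disjoint union.

block⊆ : {S : Subset n} (A : SetPartition S) {U : Subset n} → U ∈ᶜ blocks A → U ⊆ S
block⊆ A {U} U∈ {x} x∈ = Equivalence.from (union x) (U , U∈ , x∈)
  where open IsPartition (partition A)

block-nonempty : {S : Subset n} (A : SetPartition S) {U : Subset n} →
  U ∈ᶜ blocks A → Nonempty U
block-nonempty A = IsPartition.nonempty (partition A)

∩-absorb : {U R : Subset n} → U ⊆ R → U ∩ R ≡ U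
∩-absorb {U = U} {R} U⊆R =
  ⊆-antisym (proj₁ ∘ x∈p∩q⁻ U R) (λ x∈ → x∈p∩q⁺ (x∈ , U⊆R x∈))

module _ {S : Subset n} where

  open IsDecPartialOrder (≤-isDecPartialOrder {S = S}) public
    using () renaming (refl to ≤-refl; antisym to ≤-antisym)

module _ {S R : Subset n} (R⊆S : R ⊆ S) where

  ∈-restrict⁺ : (A : SetPartition S) {V : Subset n} → V ∈ᶜ blocks A → Nonempty (V ∩ R) →
    V ∩ R ∈ᶜ blocks (restrict R⊆S A)
  ∈-restrict⁺ A {V} V∈ ne = ∈-comprehension⁺ (restrictBlock? (blocks A) R) (ne , V , V∈ , refl)

  ∈-restrict⁻ : (A : SetPartition S) {U : Subset n} → U ∈ᶜ blocks (restrict R⊆S A) →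
    Nonempty U × ∃ λ V → V ∈ᶜ blocks A × U ≡ V ∩ R
  ∈-restrict⁻ A = ∈-comprehension⁻ (restrictBlock? (blocks A) R)

  -- The hypothesis is refinement written out, because `A` and `C` partition different sets. A block
  -- of `A` inside `V` is also inside `V ∩ R`, which is therefore nonempty and a block of the
  -- restriction.
  ≤-restrict⁺ : (A : SetPartition R) (C : SetPartition S) →
    (∀ U → U ∈ᶜ blocks A → ∃ λ V → V ∈ᶜ blocks C × U ⊆ V) → A ≤ restrict R⊆S C
  ≤-restrict⁺ A C f U U∈ =
    let (V , V∈ , U⊆V) = f U U∈
        U⊆∩ : U ⊆ V ∩ R
        U⊆∩ x∈ = x∈p∩q⁺ (U⊆V x∈ , block⊆ A U∈ x∈)
        (x , x∈U) = block-nonempty A U∈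
    in V ∩ R , ∈-restrict⁺ C V∈ (x , U⊆∩ x∈U) , U⊆∩

  ≤-restrict⁻ : (A : SetPartition R) (C : SetPartition S) → A ≤ restrict R⊆S C →
    ∀ U → U ∈ᶜ blocks A → ∃ λ V → V ∈ᶜ blocks C × U ⊆ V
  ≤-restrict⁻ A C A≤ U U∈ with A≤ U U∈
  ... | W , W∈ , U⊆W with ∈-restrict⁻ C W∈
  ... | _ , V , V∈ , refl = V , V∈ , proj₁ ∘ x∈p∩q⁻ V R ∘ U⊆W

  restrict-mono : (A C : SetPartition S) → A ≤ C → restrict R⊆S A ≤ restrict R⊆S C
  restrict-mono A C A≤C = ≤-restrict⁺ (restrict R⊆S A) C λ U U∈ →
    -- Reflexivity, read through `≤-restrict⁻`, places each block of the restriction inside a block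
    -- of `A`.
    let (V , V∈ , U⊆V) = ≤-restrict⁻ (restrict R⊆S A) A (≤-refl {x = restrict R⊆S A}) U U∈
        (W , W∈ , V⊆W) = A≤C V V∈
    in W , W∈ , V⊆W ∘ U⊆V

-- By this symmetry the facts about `restrict₂` follow from those about `restrict₁`.
swap : {S S₁ S₂ : Subset n} → Decomposition S S₁ S₂ → Decomposition S S₂ S₁
swap {S₁ = S₁} {S₂} d = record
  { disjoint = λ (x , x∈) → disjoint (x , subst (x ∈_) (∩-comm S₂ S₁) x∈)
  ; union    = trans (∪-comm S₂ S₁) union
  }
  where open Decomposition d

module _ {S S₁ S₂ : Subset n} (d : Decomposition S S₁ S₂) where

  ∈-disjointUnion⁺ : (A : SetPartition S₁) (B : SetPartition S₂) {U : Subset n} →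
    U ∈ᶜ blocks A ⊎ U ∈ᶜ blocks B → U ∈ᶜ blocks (disjointUnion d A B)
  ∈-disjointUnion⁺ A B = ∈-comprehension⁺ (unionBlock? (blocks A) (blocks B))

  ∈-disjointUnion⁻ : (A : SetPartition S₁) (B : SetPartition S₂) {U : Subset n} →
    U ∈ᶜ blocks (disjointUnion d A B) → U ∈ᶜ blocks A ⊎ U ∈ᶜ blocks B
  ∈-disjointUnion⁻ A B = ∈-comprehension⁻ (unionBlock? (blocks A) (blocks B))

  -- Blocks of `A` lie in `S₁` and are fixed by intersection with it; blocks of `B` miss `S₁` and
  -- leave no nonempty intersection.
  restrict₁-disjointUnion : (A : SetPartition S₁) (B : SetPartition S₂) →
    restrict₁ d (disjointUnion d A B) ≡ A
  restrict₁-disjointUnion A B = blocks-injective (⊆-antisymᶜ to from)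
    where
    open Decomposition d
    to : ∀ {U} → U ∈ᶜ blocks (restrict₁ d (disjointUnion d A B)) → U ∈ᶜ blocks A
    to U∈ with ∈-restrict⁻ left (disjointUnion d A B) U∈
    ... | (x , x∈) , V , V∈ , refl with ∈-disjointUnion⁻ A B V∈
    ... | inj₁ V∈A = subst (_∈ᶜ blocks A) (sym (∩-absorb (block⊆ A V∈A))) V∈A
    ... | inj₂ V∈B = let (x∈V , x∈S₁) = x∈p∩q⁻ V S₁ x∈ in
      contradiction (x , x∈p∩q⁺ (x∈S₁ , block⊆ B V∈B x∈V)) disjoint
    from : ∀ {U} → U ∈ᶜ blocks A → U ∈ᶜ blocks (restrict₁ d (disjointUnion d A B))
    from {U} U∈ = subst (_∈ᶜ blocks (restrict₁ d (disjointUnion d A B))) U∩S₁≡U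
      (∈-restrict⁺ left (disjointUnion d A B) (∈-disjointUnion⁺ A B (inj₁ U∈))
        (subst Nonempty (sym U∩S₁≡U) (block-nonempty A U∈)))
      where
      U∩S₁≡U : U ∩ S₁ ≡ U
      U∩S₁≡U = ∩-absorb (block⊆ A U∈)

disjointUnion-comm : {S S₁ S₂ : Subset n} (d : Decomposition S S₁ S₂)
  (A : SetPartition S₁) (B : SetPartition S₂) →
  disjointUnion d A B ≡ disjointUnion (swap d) B A
disjointUnion-comm d A B = blocks-injective (⊆-antisymᶜ
  (∈-disjointUnion⁺ (swap d) B A ∘ Sum.swap ∘ ∈-disjointUnion⁻ d A B)
  (∈-disjointUnion⁺ d A B ∘ Sum.swap ∘ ∈-disjointUnion⁻ (swap d) B A))

-- Coordinates of the basis x.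

module _ {S : Subset n} where

  open MöbiusInversion (≤-isDecPartialOrder {S = S}) public
    using (∑-≤-injective)
  open MöbiusInversion (≤-isDecPartialOrder {S = S}) using (∑-möbius)

  𝐱-coordinate : ∀ A C → 𝐱 A C ≡ ∑ (partitions S) (λ B → ⟦ B ≤? A ⟧ * (u B A * ⟦ B ≤? C ⟧))
  𝐱-coordinate A C = trans
    (∑-filter (_≤? A) (partitions S) (λ B → u B A * 𝐩 B C))
    (∑-cong (partitions S) λ B → cong (λ a → ⟦ B ≤? A ⟧ * (u B A * a))
      (∑-filter-basis (B ≤?_) C))

  -- After the exchange of sums, the inner sum runs over the `B` between `D` and `A`, where the
  -- values `u D B` add up to the indicator of `D ≡ A`.
  ∑-𝐱 : ∀ A C → ∑ (partitions S) (λ B → ⟦ B ≤? A ⟧ * 𝐱 B C) ≡ ⟦ A ≤? C ⟧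
  ∑-𝐱 A C = begin
    ∑ Π (λ B → ⟦ B ≤? A ⟧ * 𝐱 B C)
      ≡⟨ ∑-cong Π (λ B → trans (cong (⟦ B ≤? A ⟧ *_) (𝐱-coordinate B C))
           (*-distribˡ-∑ Π ⟦ B ≤? A ⟧ (λ D → ⟦ D ≤? B ⟧ * (u D B * ⟦ D ≤? C ⟧)))) ⟩
    ∑ Π (λ B → ∑ Π (λ D → ⟦ B ≤? A ⟧ * (⟦ D ≤? B ⟧ * (u D B * ⟦ D ≤? C ⟧))))
      ≡⟨ ∑-swap Π Π (λ B D → ⟦ B ≤? A ⟧ * (⟦ D ≤? B ⟧ * (u D B * ⟦ D ≤? C ⟧))) ⟩
    ∑ Π (λ D → ∑ Π (λ B → ⟦ B ≤? A ⟧ * (⟦ D ≤? B ⟧ * (u D B * ⟦ D ≤? C ⟧))))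
      ≡⟨ ∑-cong Π (λ D → trans
           (∑-cong Π λ B → *-assoc₄ ⟦ B ≤? A ⟧ ⟦ D ≤? B ⟧ (u D B) ⟦ D ≤? C ⟧)
           (sym (*-distribʳ-∑ Π ⟦ D ≤? C ⟧ (λ B → ⟦ B ≤? A ⟧ * (⟦ D ≤? B ⟧ * u D B))))) ⟩
    ∑ Π (λ D → ∑ Π (λ B → ⟦ B ≤? A ⟧ * (⟦ D ≤? B ⟧ * u D B)) * ⟦ D ≤? C ⟧)
      ≡⟨ ∑-cong Π (λ D → cong (_* ⟦ D ≤? C ⟧) (∑-möbius D A)) ⟩
    ∑ Π (λ D → ⟦ D ≟ A ⟧ * ⟦ D ≤? C ⟧)
      ≡⟨ ∑-δ (_≟ A) A (λ D → ⟦ D ≤? C ⟧) refl (λ eq → eq) ⟩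
    ⟦ A ≤? C ⟧ ∎
    where
    Π : List (SetPartition S)
    Π = partitions S

-- Disjoint unions in the refinement order.

module _ {S S₁ S₂ : Subset n} (d : Decomposition S S₁ S₂) where

  open Decomposition d using (left; right)

  private
    infixl 6 _⊔_
    infix 25 _₁ _₂
    _⊔_ : SetPartition S₁ → SetPartition S₂ → SetPartition S
    _⊔_ = disjointUnion d

    Π : List (SetPartition S)
    Π = partitions S

    Π₁ : List (SetPartition S₁)
    Π₁ = partitions S₁

    Π₂ : List (SetPartition S₂)
    Π₂ = partitions S₂

    _₁ : SetPartition S → SetPartition S₁
    _₁ = restrict₁ d

    _₂ : SetPartition S → SetPartition S₂
    _₂ = restrict₂ d

  restrict₂-disjointUnion : ∀ A B → restrict₂ d (A ⊔ B) ≡ B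
  restrict₂-disjointUnion A B = trans (cong (restrict₂ d) (disjointUnion-comm d A B))
    (restrict₁-disjointUnion (swap d) B A)

  disjointUnion-splits : ∀ A B → Splits d (A ⊔ B)
  disjointUnion-splits A B =
    sym (cong₂ _⊔_ (restrict₁-disjointUnion d A B) (restrict₂-disjointUnion A B))

  -- Together with `disjointUnion-≤⁻` this is an adjunction: disjoint union is left adjoint to the
  -- pair of restrictions, as both sides say that every block of `A` or `B` lies in a block of `C`.
  disjointUnion-≤⁺ : ∀ A B C → A ≤ restrict₁ d C → B ≤ restrict₂ d C → A ⊔ B ≤ C
  disjointUnion-≤⁺ A B C A≤ B≤ U U∈ =
    [ ≤-restrict⁻ left A C A≤ U , ≤-restrict⁻ right B C B≤ U ]′ (∈-disjointUnion⁻ d A B U∈)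

  disjointUnion-≤⁻ : ∀ A B C → A ⊔ B ≤ C → A ≤ restrict₁ d C × B ≤ restrict₂ d C
  disjointUnion-≤⁻ A B C A⊔B≤C =
    ≤-restrict⁺ left A C (λ U U∈ → A⊔B≤C U (∈-disjointUnion⁺ d A B (inj₁ U∈))) ,
    ≤-restrict⁺ right B C (λ U U∈ → A⊔B≤C U (∈-disjointUnion⁺ d A B (inj₂ U∈)))

  disjointUnion-mono : ∀ {A A′ B B′} → A ≤ A′ → B ≤ B′ → A ⊔ B ≤ A′ ⊔ B′
  disjointUnion-mono {A} {A′} {B} {B′} A≤A′ B≤B′ = disjointUnion-≤⁺ A B (A′ ⊔ B′)
    (subst (A ≤_) (sym (restrict₁-disjointUnion d A′ B′)) A≤A′)
    (subst (B ≤_) (sym (restrict₂-disjointUnion A′ B′)) B≤B′)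

  ≤-disjointUnion⁻ : ∀ D A B → D ≤ A ⊔ B → restrict₁ d D ≤ A × restrict₂ d D ≤ B
  ≤-disjointUnion⁻ D A B D≤ =
    subst (restrict₁ d D ≤_) (restrict₁-disjointUnion d A B)
      (restrict-mono left D (A ⊔ B) D≤) ,
    subst (restrict₂ d D ≤_) (restrict₂-disjointUnion A B)
      (restrict-mono right D (A ⊔ B) D≤)

  -- Each block of D lies in a block of A or of B, hence in S₁ or in S₂, and
  -- is therefore equal to its restriction.
  ≤-disjointUnion⇒splits : ∀ D A B → D ≤ A ⊔ B → Splits d D
  ≤-disjointUnion⇒splits D A B D≤ = ≤-antisym D≤D₁⊔D₂
    (disjointUnion-≤⁺ (restrict₁ d D) (restrict₂ d D) D
      (≤-refl {x = restrict₁ d D}) (≤-refl {x = restrict₂ d D}))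
    where
    restricts : ∀ {R} (R⊆S : R ⊆ S) {V} → V ∈ᶜ blocks D → V ⊆ R →
      V ∈ᶜ blocks (restrict R⊆S D)
    restricts {R} R⊆S {V} V∈ V⊆R = subst (_∈ᶜ blocks (restrict R⊆S D)) (∩-absorb V⊆R)
      (∈-restrict⁺ R⊆S D V∈ (subst Nonempty (sym (∩-absorb V⊆R)) (block-nonempty D V∈)))
    D≤D₁⊔D₂ : D ≤ restrict₁ d D ⊔ restrict₂ d D
    D≤D₁⊔D₂ V V∈ with D≤ V V∈
    ... | W , W∈ , V⊆W = V , ∈-disjointUnion⁺ d (restrict₁ d D) (restrict₂ d D)
      ([ (λ W∈A → inj₁ (restricts left  V∈ (λ x∈ → block⊆ A W∈A (V⊆W x∈))))
       , (λ W∈B → inj₂ (restricts right V∈ (λ x∈ → block⊆ B W∈B (V⊆W x∈))))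
       ]′ (∈-disjointUnion⁻ d A B W∈)) , (λ x∈ → x∈)

  -- Product and coproduct in coordinates.

  -- Each `C` occurs in the product of exactly one pair of m-basis elements, the pair indexed by its
  -- two restrictions.
  μ-coordinate : ∀ v C → μ d v C ≡ v (C ₁ , C ₂)
  μ-coordinate v C = begin
    ∑ Π₁₂ (λ (A , B) → v (A , B) * ∑ᵥ (filter (fibre? A B) Π) 𝐦 C)
      ≡⟨ ∑-cong Π₁₂ (λ (A , B) → trans
           (cong (v (A , B) *_) (∑-filter-basis (fibre? A B) C))
           (*-comm (v (A , B)) ⟦ fibre? A B C ⟧)) ⟩
    ∑ Π₁₂ (λ (A , B) → ⟦ fibre? A B C ⟧ * v (A , B))
      ≡⟨ ∑-δ (λ (A , B) → fibre? A B C) (C ₁ , C ₂) v (refl , refl) (λ { (refl , refl) → refl }) ⟩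
    v (C ₁ , C ₂) ∎
    where
    Π₁₂ : List (SetPartition S₁ × SetPartition S₂)
    Π₁₂ = elements
    fibre? : ∀ A B C → Dec (C ₁ ≡ A × C ₂ ≡ B)
    fibre? A B C = (C ₁ ≟ A) ×-dec (C ₂ ≟ B)

  -- The only partition that splits with restrictions `E₁` and `E₂` is `E₁ ⊔ E₂`, so it alone
  -- contributes.
  Δ-coordinate : ∀ v E₁ E₂ → Δ d v (E₁ , E₂) ≡ v (E₁ ⊔ E₂)
  Δ-coordinate v E₁ E₂ = trans (∑-cong Π term) (∑-δ (_≟ (E₁ ⊔ E₂)) (E₁ ⊔ E₂) v refl (λ eq → eq))
    where
    to : ∀ {A} → Splits d A × (A ₁ ≡ E₁ × A ₂ ≡ E₂) → A ≡ E₁ ⊔ E₂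
    to (A≡ , refl , refl) = A≡
    from : ∀ {A} → A ≡ E₁ ⊔ E₂ → Splits d A × (A ₁ ≡ E₁ × A ₂ ≡ E₂)
    from refl = disjointUnion-splits E₁ E₂ ,
      restrict₁-disjointUnion d E₁ E₂ , restrict₂-disjointUnion E₁ E₂
    if-⟦⟧ : ∀ {P : Set} (P? : Dec P) (w : 𝚷⊗𝚷 S₁ S₂) →
      (if does P? then w else 0ᵥ) (E₁ , E₂) ≡ ⟦ P? ⟧ * w (E₁ , E₂)
    if-⟦⟧ (yes _) w = sym (*-identityˡ (w (E₁ , E₂)))
    if-⟦⟧ (no _)  w = sym (*-zeroˡ (w (E₁ , E₂)))
    term : ∀ A → v A * (if does (splits? d A) then 𝐦 (A ₁) ⊗ 𝐦 (A ₂) else 0ᵥ) (E₁ , E₂)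
               ≡ ⟦ A ≟ (E₁ ⊔ E₂) ⟧ * v A
    term A = begin
      v A * (if does (splits? d A) then 𝐦 (A ₁) ⊗ 𝐦 (A ₂) else 0ᵥ) (E₁ , E₂)
        ≡⟨ cong (v A *_) (if-⟦⟧ (splits? d A) (𝐦 (A ₁) ⊗ 𝐦 (A ₂))) ⟩
      v A * (⟦ splits? d A ⟧ * (⟦ A ₁ ≟ E₁ ⟧ * ⟦ A ₂ ≟ E₂ ⟧))
        ≡⟨ cong (v A *_) (⟦⟧-×₃ (splits? d A) (A ₁ ≟ E₁) (A ₂ ≟ E₂)) ⟨
      v A * ⟦ splits? d A ×-dec ((A ₁ ≟ E₁) ×-dec (A ₂ ≟ E₂)) ⟧
        ≡⟨ *-comm (v A) _ ⟩
      ⟦ splits? d A ×-dec ((A ₁ ≟ E₁) ×-dec (A ₂ ≟ E₂)) ⟧ * v A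
        ≡⟨ cong (_* v A) (⟦⟧-⇔ (splits? d A ×-dec ((A ₁ ≟ E₁) ×-dec (A ₂ ≟ E₂)))
             (A ≟ (E₁ ⊔ E₂)) to from) ⟩
      ⟦ A ≟ (E₁ ⊔ E₂) ⟧ * v A ∎

  -- Multiplicativity of the basis x.

  -- The reindexing is done without a bijection of lists: a sum over `D` with the indicator of
  -- `D ≡ A′ ⊔ B′` is inserted, the sums are exchanged, and for each `D` below `A ⊔ B` a single pair
  -- survives.
  ∑-≤-disjointUnion : ∀ A B (f : SetPartition S → ℚ) →
    ∑ Π₁ (λ A′ → ⟦ A′ ≤? A ⟧ * ∑ Π₂ (λ B′ → ⟦ B′ ≤? B ⟧ * f (A′ ⊔ B′)))
      ≡ ∑ Π (λ D → ⟦ D ≤? (A ⊔ B) ⟧ * f D)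
  ∑-≤-disjointUnion A B f = begin
    ∑ Π₁ (λ A′ → ⟦ A′ ≤? A ⟧ * ∑ Π₂ (λ B′ → ⟦ B′ ≤? B ⟧ * f (A′ ⊔ B′)))
      ≡⟨ ∑-cong Π₁ (λ A′ → begin
           ⟦ A′ ≤? A ⟧ * ∑ Π₂ (λ B′ → ⟦ B′ ≤? B ⟧ * f (A′ ⊔ B′))
             ≡⟨ cong (⟦ A′ ≤? A ⟧ *_) (trans
                  (∑-cong Π₂ λ B′ → expand A′ B′)
                  (∑-swap Π₂ Π λ B′ D → ⟦ B′ ≤? B ⟧ * (⟦ D ≟ (A′ ⊔ B′) ⟧ * f D))) ⟩
           ⟦ A′ ≤? A ⟧ * ∑ Π (λ D → ∑ Π₂ (λ B′ → ⟦ B′ ≤? B ⟧ * (⟦ D ≟ (A′ ⊔ B′) ⟧ * f D)))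
             ≡⟨ *-distribˡ-∑ Π ⟦ A′ ≤? A ⟧
                  (λ D → ∑ Π₂ (λ B′ → ⟦ B′ ≤? B ⟧ * (⟦ D ≟ (A′ ⊔ B′) ⟧ * f D))) ⟩
           ∑ Π (λ D → ⟦ A′ ≤? A ⟧ * ∑ Π₂ (λ B′ → ⟦ B′ ≤? B ⟧ * (⟦ D ≟ (A′ ⊔ B′) ⟧ * f D))) ∎) ⟩
    ∑ Π₁ (λ A′ → ∑ Π (λ D →
        ⟦ A′ ≤? A ⟧ * ∑ Π₂ (λ B′ → ⟦ B′ ≤? B ⟧ * (⟦ D ≟ (A′ ⊔ B′) ⟧ * f D))))
      ≡⟨ ∑-swap Π₁ Π (λ A′ D →
           ⟦ A′ ≤? A ⟧ * ∑ Π₂ (λ B′ → ⟦ B′ ≤? B ⟧ * (⟦ D ≟ (A′ ⊔ B′) ⟧ * f D))) ⟩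
    ∑ Π (λ D → ∑ Π₁ (λ A′ →
        ⟦ A′ ≤? A ⟧ * ∑ Π₂ (λ B′ → ⟦ B′ ≤? B ⟧ * (⟦ D ≟ (A′ ⊔ B′) ⟧ * f D))))
      ≡⟨ ∑-cong Π collapse ⟩
    ∑ Π (λ D → ⟦ D ≤? (A ⊔ B) ⟧ * f D) ∎
    where
    expand : ∀ A′ B′ → ⟦ B′ ≤? B ⟧ * f (A′ ⊔ B′) ≡
      ∑ Π (λ D → ⟦ B′ ≤? B ⟧ * (⟦ D ≟ (A′ ⊔ B′) ⟧ * f D))
    expand A′ B′ = trans
      (cong (⟦ B′ ≤? B ⟧ *_) (sym (∑-δ (_≟ (A′ ⊔ B′)) (A′ ⊔ B′) f refl (λ eq → eq))))
      (*-distribˡ-∑ Π ⟦ B′ ≤? B ⟧ (λ D → ⟦ D ≟ (A′ ⊔ B′) ⟧ * f D))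

    to : ∀ {D A′ B′} → A′ ≤ A × B′ ≤ B × D ≡ A′ ⊔ B′ → A′ ≡ D ₁ × B′ ≡ D ₂ × D ≤ A ⊔ B
    to {A′ = A′} {B′} (A′≤A , B′≤B , refl) =
      sym (restrict₁-disjointUnion d A′ B′) , sym (restrict₂-disjointUnion A′ B′) ,
      disjointUnion-mono {A′} {A} {B′} {B} A′≤A B′≤B

    from : ∀ {D A′ B′} → A′ ≡ D ₁ × B′ ≡ D ₂ × D ≤ A ⊔ B → A′ ≤ A × B′ ≤ B × D ≡ A′ ⊔ B′
    from {D} (refl , refl , D≤) =
      let (D₁≤A , D₂≤B) = ≤-disjointUnion⁻ D A B D≤
      in D₁≤A , D₂≤B , ≤-disjointUnion⇒splits D A B D≤

    -- In terms of indicators: `A′ ⊔ B′` runs through the ideal below `A ⊔ B`, and the inverse map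
    -- takes `D` to its pair of restrictions.
    swap-conditions : ∀ D A′ B′ →
      ⟦ A′ ≤? A ⟧ * (⟦ B′ ≤? B ⟧ * ⟦ D ≟ (A′ ⊔ B′) ⟧) ≡
      ⟦ A′ ≟ D ₁ ⟧ * (⟦ B′ ≟ D ₂ ⟧ * ⟦ D ≤? (A ⊔ B) ⟧)
    swap-conditions D A′ B′ = begin
      ⟦ A′ ≤? A ⟧ * (⟦ B′ ≤? B ⟧ * ⟦ D ≟ (A′ ⊔ B′) ⟧)
        ≡⟨ ⟦⟧-×₃ (A′ ≤? A) (B′ ≤? B) (D ≟ (A′ ⊔ B′)) ⟨
      ⟦ (A′ ≤? A) ×-dec ((B′ ≤? B) ×-dec (D ≟ (A′ ⊔ B′))) ⟧
        ≡⟨ ⟦⟧-⇔ ((A′ ≤? A) ×-dec ((B′ ≤? B) ×-dec (D ≟ (A′ ⊔ B′))))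
             ((A′ ≟ D ₁) ×-dec ((B′ ≟ D ₂) ×-dec (D ≤? (A ⊔ B)))) to from ⟩
      ⟦ (A′ ≟ D ₁) ×-dec ((B′ ≟ D ₂) ×-dec (D ≤? (A ⊔ B))) ⟧
        ≡⟨ ⟦⟧-×₃ (A′ ≟ D ₁) (B′ ≟ D ₂) (D ≤? (A ⊔ B)) ⟩
      ⟦ A′ ≟ D ₁ ⟧ * (⟦ B′ ≟ D ₂ ⟧ * ⟦ D ≤? (A ⊔ B) ⟧) ∎

    collapse : ∀ D →
      ∑ Π₁ (λ A′ → ⟦ A′ ≤? A ⟧ * ∑ Π₂ (λ B′ → ⟦ B′ ≤? B ⟧ * (⟦ D ≟ (A′ ⊔ B′) ⟧ * f D)))
        ≡ ⟦ D ≤? (A ⊔ B) ⟧ * f D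
    collapse D = begin
      ∑ Π₁ (λ A′ → ⟦ A′ ≤? A ⟧ * ∑ Π₂ (λ B′ → ⟦ B′ ≤? B ⟧ * (⟦ D ≟ (A′ ⊔ B′) ⟧ * f D)))
        ≡⟨ ∑-cong Π₁ (λ A′ → trans
             (*-distribˡ-∑ Π₂ ⟦ A′ ≤? A ⟧ (λ B′ → ⟦ B′ ≤? B ⟧ * (⟦ D ≟ (A′ ⊔ B′) ⟧ * f D)))
             (∑-cong Π₂ λ B′ → trans
               (*-assoc₄ ⟦ A′ ≤? A ⟧ ⟦ B′ ≤? B ⟧ ⟦ D ≟ (A′ ⊔ B′) ⟧ (f D)) (trans
               (cong (_* f D) (swap-conditions D A′ B′))
               (sym (*-assoc₄ ⟦ A′ ≟ D ₁ ⟧ ⟦ B′ ≟ D ₂ ⟧ ⟦ D ≤? (A ⊔ B) ⟧ (f D)))))) ⟩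
      ∑ Π₁ (λ A′ → ∑ Π₂ (λ B′ →
          ⟦ A′ ≟ D ₁ ⟧ * (⟦ B′ ≟ D ₂ ⟧ * (⟦ D ≤? (A ⊔ B) ⟧ * f D))))
        ≡⟨ ∑-cong Π₁ (λ A′ → trans
             (sym (*-distribˡ-∑ Π₂ ⟦ A′ ≟ D ₁ ⟧
               (λ B′ → ⟦ B′ ≟ D ₂ ⟧ * (⟦ D ≤? (A ⊔ B) ⟧ * f D))))
             (cong (⟦ A′ ≟ D ₁ ⟧ *_)
               (∑-δ (_≟ D ₂) (D ₂) (λ _ → ⟦ D ≤? (A ⊔ B) ⟧ * f D) refl (λ eq → eq)))) ⟩
      ∑ Π₁ (λ A′ → ⟦ A′ ≟ D ₁ ⟧ * (⟦ D ≤? (A ⊔ B) ⟧ * f D))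
        ≡⟨ ∑-δ (_≟ D ₁) (D ₁) (λ _ → ⟦ D ≤? (A ⊔ B) ⟧ * f D) refl (λ eq → eq) ⟩
      ⟦ D ≤? (A ⊔ B) ⟧ * f D ∎

  𝐱-multiplicative : ∀ A B C → 𝐱 A (C ₁) * 𝐱 B (C ₂) ≡ 𝐱 (A ⊔ B) C
  -- With `C` fixed, the outer call inverts the ideal sums in the second partition and the inner
  -- call those in the first.
  𝐱-multiplicative A B C = ∑-≤-injective
    (λ B → ∑-≤-injective
      {f = λ A → ∑ Π₂ (λ B′ → ⟦ B′ ≤? B ⟧ * (𝐱 A (C ₁) * 𝐱 B′ (C ₂)))}
      {g = λ A → ∑ Π₂ (λ B′ → ⟦ B′ ≤? B ⟧ * 𝐱 (A ⊔ B′) C)}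
      (λ A → ideals A B) A) B
    where
    product : ∀ A B → ∑ Π₁ (λ A′ → ⟦ A′ ≤? A ⟧ *
        ∑ Π₂ (λ B′ → ⟦ B′ ≤? B ⟧ * (𝐱 A′ (C ₁) * 𝐱 B′ (C ₂)))) ≡ ⟦ A ≤? C ₁ ⟧ * ⟦ B ≤? C ₂ ⟧
    product A B = begin
      ∑ Π₁ (λ A′ → ⟦ A′ ≤? A ⟧ * ∑ Π₂ (λ B′ → ⟦ B′ ≤? B ⟧ * (𝐱 A′ (C ₁) * 𝐱 B′ (C ₂))))
        ≡⟨ ∑-cong Π₁ (λ A′ → trans
             (cong (⟦ A′ ≤? A ⟧ *_) (trans
               (∑-cong Π₂ λ B′ → x*yz≡y*xz ⟦ B′ ≤? B ⟧ (𝐱 A′ (C ₁)) (𝐱 B′ (C ₂)))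
               (sym (*-distribˡ-∑ Π₂ (𝐱 A′ (C ₁)) (λ B′ → ⟦ B′ ≤? B ⟧ * 𝐱 B′ (C ₂))))))
             (sym (*-assoc ⟦ A′ ≤? A ⟧ (𝐱 A′ (C ₁)) _))) ⟩
      ∑ Π₁ (λ A′ → (⟦ A′ ≤? A ⟧ * 𝐱 A′ (C ₁)) * ∑ Π₂ (λ B′ → ⟦ B′ ≤? B ⟧ * 𝐱 B′ (C ₂)))
        ≡⟨ *-distribʳ-∑ Π₁ (∑ Π₂ (λ B′ → ⟦ B′ ≤? B ⟧ * 𝐱 B′ (C ₂)))
             (λ A′ → ⟦ A′ ≤? A ⟧ * 𝐱 A′ (C ₁)) ⟨
      ∑ Π₁ (λ A′ → ⟦ A′ ≤? A ⟧ * 𝐱 A′ (C ₁)) * ∑ Π₂ (λ B′ → ⟦ B′ ≤? B ⟧ * 𝐱 B′ (C ₂))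
        ≡⟨ cong₂ _*_ (∑-𝐱 A (C ₁)) (∑-𝐱 B (C ₂)) ⟩
      ⟦ A ≤? C ₁ ⟧ * ⟦ B ≤? C ₂ ⟧ ∎

    ideals : ∀ A B →
      ∑ Π₁ (λ A′ → ⟦ A′ ≤? A ⟧ * ∑ Π₂ (λ B′ → ⟦ B′ ≤? B ⟧ * (𝐱 A′ (C ₁) * 𝐱 B′ (C ₂)))) ≡
      ∑ Π₁ (λ A′ → ⟦ A′ ≤? A ⟧ * ∑ Π₂ (λ B′ → ⟦ B′ ≤? B ⟧ * 𝐱 (A′ ⊔ B′) C))
    ideals A B = begin
      ∑ Π₁ (λ A′ → ⟦ A′ ≤? A ⟧ * ∑ Π₂ (λ B′ → ⟦ B′ ≤? B ⟧ * (𝐱 A′ (C ₁) * 𝐱 B′ (C ₂))))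
        ≡⟨ product A B ⟩
      ⟦ A ≤? C ₁ ⟧ * ⟦ B ≤? C ₂ ⟧
        ≡⟨ ⟦⟧-× (A ≤? C ₁) (B ≤? C ₂) ⟨
      ⟦ (A ≤? C ₁) ×-dec (B ≤? C ₂) ⟧
        ≡⟨ ⟦⟧-⇔ ((A ≤? C ₁) ×-dec (B ≤? C ₂)) ((A ⊔ B) ≤? C)
             (λ (A≤ , B≤) → disjointUnion-≤⁺ A B C A≤ B≤) (disjointUnion-≤⁻ A B C) ⟩
      ⟦ (A ⊔ B) ≤? C ⟧
        ≡⟨ ∑-𝐱 (A ⊔ B) C ⟨
      ∑ Π (λ D → ⟦ D ≤? (A ⊔ B) ⟧ * 𝐱 D C)
        ≡⟨ ∑-≤-disjointUnion A B (λ D → 𝐱 D C) ⟨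
      ∑ Π₁ (λ A′ → ⟦ A′ ≤? A ⟧ * ∑ Π₂ (λ B′ → ⟦ B′ ≤? B ⟧ * 𝐱 (A′ ⊔ B′) C)) ∎

  -- Coproduct of the basis x.

  -- The left side is the coordinate of `Δ d (𝐩 D)` at `(E₁ , E₂)`. For the converse direction,
  -- splitting rewrites `D` as `D ₁ ⊔ D ₂`, and disjoint union is monotone.
  ≤-disjointUnion-⟦⟧ : ∀ D E₁ E₂ →
    ⟦ D ≤? (E₁ ⊔ E₂) ⟧ ≡ ⟦ splits? d D ⟧ * (⟦ D ₁ ≤? E₁ ⟧ * ⟦ D ₂ ≤? E₂ ⟧)
  ≤-disjointUnion-⟦⟧ D E₁ E₂ = trans
    (⟦⟧-⇔ (D ≤? (E₁ ⊔ E₂)) (splits? d D ×-dec ((D ₁ ≤? E₁) ×-dec (D ₂ ≤? E₂)))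
      (λ D≤ → ≤-disjointUnion⇒splits D E₁ E₂ D≤ , ≤-disjointUnion⁻ D E₁ E₂ D≤)
      (λ (D≡ , D₁≤ , D₂≤) → subst (_≤ (E₁ ⊔ E₂)) (sym D≡)
        (disjointUnion-mono {D ₁} {E₁} {D ₂} {E₂} D₁≤ D₂≤)))
    (⟦⟧-×₃ (splits? d D) (D ₁ ≤? E₁) (D ₂ ≤? E₂))

  -- The sum over `D` hidden in `c` is moved outside. For fixed `D` the sums over `B` and `C` are
  -- independent, and `∑-𝐱` evaluates each of them.
  ∑-c-𝐱⊗𝐱 : ∀ A E₁ E₂ →
    ∑ Π₁ (λ B → ∑ Π₂ (λ C → c d A B C * (𝐱 B E₁ * 𝐱 C E₂))) ≡ 𝐱 A (E₁ ⊔ E₂)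
  ∑-c-𝐱⊗𝐱 A E₁ E₂ = begin
    ∑ Π₁ (λ B → ∑ Π₂ (λ C → c d A B C * (𝐱 B E₁ * 𝐱 C E₂)))
      ≡⟨ ∑-cong Π₁ (λ B → trans (∑-cong Π₂ (expand B)) (∑-swap Π₂ Π (summand B))) ⟩
    ∑ Π₁ (λ B → ∑ Π (λ D → ∑ Π₂ (λ C → summand B C D)))
      ≡⟨ ∑-swap Π₁ Π (λ B D → ∑ Π₂ (λ C → summand B C D)) ⟩
    ∑ Π (λ D → ∑ Π₁ (λ B → ∑ Π₂ (λ C → summand B C D)))
      ≡⟨ ∑-cong Π collapse ⟩
    ∑ Π (λ D → ⟦ D ≤? A ⟧ * (u D A * ⟦ D ≤? (E₁ ⊔ E₂) ⟧))
      ≡⟨ 𝐱-coordinate A (E₁ ⊔ E₂) ⟨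
    𝐱 A (E₁ ⊔ E₂) ∎
    where
    weight : SetPartition S → ℚ
    weight D = ⟦ splits? d D ⟧ * (⟦ D ≤? A ⟧ * u D A)

    -- Each condition on `B` or `C` is grouped with the matching `𝐱` factor, which makes the double
    -- sum a product.
    summand : SetPartition S₁ → SetPartition S₂ → SetPartition S → ℚ
    summand B C D = weight D * ((⟦ B ≤? D ₁ ⟧ * 𝐱 B E₁) * (⟦ C ≤? D ₂ ⟧ * 𝐱 C E₂))

    expand : ∀ B C → c d A B C * (𝐱 B E₁ * 𝐱 C E₂) ≡ ∑ Π (summand B C)
    expand B C = trans
      (cong (_* (𝐱 B E₁ * 𝐱 C E₂)) (∑-filter condition? Π (λ D → u D A))) (trans
      (*-distribʳ-∑ Π (𝐱 B E₁ * 𝐱 C E₂) (λ D → ⟦ condition? D ⟧ * u D A))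
      (∑-cong Π λ D → trans
        (cong (λ a → a * u D A * (𝐱 B E₁ * 𝐱 C E₂)) (condition-⟦⟧ D))
        (solve 7 (λ s t b c m x y →
           ((s :* (t :* (b :* c))) :* m) :* (x :* y) := (s :* (t :* m)) :* ((b :* x) :* (c :* y)))
           refl ⟦ splits? d D ⟧ ⟦ D ≤? A ⟧ ⟦ B ≤? D ₁ ⟧ ⟦ C ≤? D ₂ ⟧ (u D A) (𝐱 B E₁) (𝐱 C E₂))))
      where
      condition? : ∀ D → Dec (Splits d D × D ≤ A × B ≤ D ₁ × C ≤ D ₂)
      condition? D = splits? d D ×-dec (D ≤? A) ×-dec (B ≤? D ₁) ×-dec (C ≤? D ₂)
      condition-⟦⟧ : ∀ D → ⟦ condition? D ⟧ ≡
        ⟦ splits? d D ⟧ * (⟦ D ≤? A ⟧ * (⟦ B ≤? D ₁ ⟧ * ⟦ C ≤? D ₂ ⟧))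
      condition-⟦⟧ D = trans
        (⟦⟧-× (splits? d D) ((D ≤? A) ×-dec (B ≤? D ₁) ×-dec (C ≤? D ₂)))
        (cong (⟦ splits? d D ⟧ *_) (⟦⟧-×₃ (D ≤? A) (B ≤? D ₁) (C ≤? D ₂)))

    collapse : ∀ D → ∑ Π₁ (λ B → ∑ Π₂ (λ C → summand B C D)) ≡
      ⟦ D ≤? A ⟧ * (u D A * ⟦ D ≤? (E₁ ⊔ E₂) ⟧)
    collapse D = begin
      ∑ Π₁ (λ B → ∑ Π₂ (λ C → summand B C D))
        ≡⟨ trans
             (*-distribˡ-∑ Π₁ (weight D) (λ B → ∑ Π₂ (λ C → f B * g C)))
             (∑-cong Π₁ λ B → *-distribˡ-∑ Π₂ (weight D) (λ C → f B * g C)) ⟨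
      weight D * ∑ Π₁ (λ B → ∑ Π₂ (λ C → f B * g C))
        ≡⟨ cong (weight D *_) (∑-*-∑ Π₁ Π₂ f g) ⟨
      weight D * (∑ Π₁ f * ∑ Π₂ g)
        ≡⟨ cong (weight D *_) (cong₂ _*_ (∑-𝐱 (D ₁) E₁) (∑-𝐱 (D ₂) E₂)) ⟩
      weight D * (⟦ D ₁ ≤? E₁ ⟧ * ⟦ D ₂ ≤? E₂ ⟧)
        ≡⟨ solve 4 (λ s t m e → (s :* (t :* m)) :* e := t :* (m :* (s :* e))) refl
             ⟦ splits? d D ⟧ ⟦ D ≤? A ⟧ (u D A) (⟦ D ₁ ≤? E₁ ⟧ * ⟦ D ₂ ≤? E₂ ⟧) ⟩
      ⟦ D ≤? A ⟧ * (u D A * (⟦ splits? d D ⟧ * (⟦ D ₁ ≤? E₁ ⟧ * ⟦ D ₂ ≤? E₂ ⟧)))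
        ≡⟨ cong (λ a → ⟦ D ≤? A ⟧ * (u D A * a)) (≤-disjointUnion-⟦⟧ D E₁ E₂) ⟨
      ⟦ D ≤? A ⟧ * (u D A * ⟦ D ≤? (E₁ ⊔ E₂) ⟧) ∎
      where
      f : SetPartition S₁ → ℚ
      f B = ⟦ B ≤? D ₁ ⟧ * 𝐱 B E₁
      g : SetPartition S₂ → ℚ
      g C = ⟦ C ≤? D ₂ ⟧ * 𝐱 C E₂

theorem3p1 : (∀ {n : ℕ} {S S₁ S₂ : Subset n} (d : Decomposition S S₁ S₂)
    (A : SetPartition S₁) (B : SetPartition S₂) →
    μ d (𝐱 A ⊗ 𝐱 B) ≗ 𝐱 (disjointUnion d A B))
    ×
    (∀ {n : ℕ} {S S₁ S₂ : Subset n} (d : Decomposition S S₁ S₂)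
    (A : SetPartition S) →
    Δ d (𝐱 A) ≗ ∑ᵥ (partitions S₁) (λ B → ∑ᵥ (partitions S₂) (λ C → c d A B C • (𝐱 B ⊗ 𝐱 C))))
theorem3p1 =
  (λ d A B C → trans (μ-coordinate d (𝐱 A ⊗ 𝐱 B) C) (𝐱-multiplicative d A B C)) ,
  (λ d A (E₁ , E₂) → trans (Δ-coordinate d (𝐱 A) E₁ E₂) (sym (∑-c-𝐱⊗𝐱 d A E₁ E₂)))
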